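{- Let $k$ and $t$ be integers, let $(G,\sigma)$ be a signed bipartite partial $t$-tree of unbalanced girth at least $2k$, and let $H$ be a $t$-tree with $V(H)=V(G)$ and $E(G)\subseteq E(H)$. Define $w:E(H)\to\mathbb{Z}$ by $$w(uv)=\begin{cases} ad_{(G,\sigma)}(u,v) & \text{if } d_G(u,v)\le k,\\ k & \text{if } d_G(u,v)>k \text{ and } d_G(u,v)\equiv k \pmod 2,\\ k-1 & \text{if } d_G(u,v)>k \text{ and } d_G(u,v)\equiv k-1 \pmod 2.\end{cases}$$ Then every $(t+1)$-clique of $H$, with the weights given by $w$, is $2k$-wide.
   Context: A $t$-tree is a graph obtained from $K_{t+1}$ by repeatedly adding a new vertex joined to all vertices of an existing subgraph isomorphic to $K_t$; a partial $t$-tree is a subgraph of a $t$-tree. A signed graph $(G,\sigma)$ is a graph with $\sigma:E(G)\to\{+,-\}$; it is a signed bipartite graph if $G$ is bipartite. The sign of a cycle or path is the product of its edge signs; the unbalanced girth is the length of a shortest negative cycle. $d_G(u,v)$ is the graph distance, and the algebraic distance is $ad_{(G,\sigma)}(u,v)=d_G(u,v)\cdot\sigma(P)$ where $P$ is a shortest $u$–$v$ path, a positive one being chosen if shortest paths of both signs exist. A signed edge-weighted graph $(K,w)$ is a graph with nonzero integer edge weights. For $(K,w)$ with $1\le|w(e)|\le k$, $\overline{\overline{(K,w)}}_{ -2k}$ is the signed graph obtained by replacing each edge $e=xy$ by two internally disjoint $x$–$y$ paths, one of length $|w(e)|$ with the sign of $w(e)$ and one of length $2k-|w(e)|$ with the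 opposite sign; $(K,w)$ is $2k$-wide if $\overline{\overline{(K,w)}}_{ -2k}$ has unbalanced girth equal to $2k$. -}

module Defs where

open import Data.Nat as ℕ using (ℕ; zero; suc; _+_; _≤_; _<_; _∸_; _%_; _≡ᵇ_)
open import Data.Integer as ℤ using (ℤ; ∣_∣)
open import Data.Sign as S using (Sign)
open import Data.Fin as F using (Fin)
open import Data.Bool using (Bool; true; false; if_then_else_)
open import Data.List using (List; []; _∷_)
open import Data.List.Relation.Unary.Unique.Propositional using (Unique)
open import Data.Product using (Σ; ∃; _×_; _,_)
open import Data.Sum using (_⊎_)
open import Data.Empty using (⊥)
open import Relation.Nullary using (¬_)
open import Relation.Binary.PropositionalEquality using (_≡_; _≢_)
open import Function.Bundles using (_↔_; _⇔_; Inverse)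
open import Function.Definitions using (Injective)

------------------------------------------------------------------------
-- Simple graphs on the vertex set Fin n

record Graph (n : ℕ) : Set₁ where
  field
    Adj        : Fin n → Fin n → Set
    Adj-sym    : ∀ {u v} → Adj u v → Adj v u
    Adj-irrefl : ∀ {u} → ¬ Adj u u
open Graph public

------------------------------------------------------------------------
-- t-trees (on vertex sets Fin n), following the inductive construction,
-- closed under relabelling of vertices (isomorphism).

-- add a new vertex (zero) joined exactly to the image of s
extend : ∀ {n t} → (Fin n → Fin n → Set) → (Fin t → Fin n) →
         Fin (suc n) → Fin (suc n) → Set
extend A s F.zero    F.zero    = ⊥
extend A s F.zero    (F.suc v) = ∃ λ i → s i ≡ v
extend A s (F.suc u) F.zero    = ∃ λ i → s i ≡ u
extend A s (F.suc u) (F.suc v) = A u v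

data IsTTree (t : ℕ) : {n : ℕ} → (Fin n → Fin n → Set) → Set₁ where
  -- K_{t+1}
  base    : IsTTree t {suc t} (λ u v → u ≢ v)
  -- add a vertex joined to all vertices of a t-clique (s injective, pairwise adjacent)
  add     : ∀ {n} {A : Fin n → Fin n → Set} → IsTTree t A →
            (s : Fin t → Fin n) → Injective _≡_ _≡_ s →
            (∀ i j → i ≢ j → A (s i) (s j)) →
            IsTTree t (extend A s)
  -- isomorphic copies
  relabel : ∀ {n} {A B : Fin n → Fin n → Set} → IsTTree t A →
            (π : Fin n ↔ Fin n) →
            (∀ u v → B (Inverse.to π u) (Inverse.to π v) ⇔ A u v) →
            IsTTree t B

-- partial t-tree: subgraph of a t-tree
IsPartialTTree : (t : ℕ) → ∀ {n} → (Fin n → Fin n → Set) → Set₁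
IsPartialTTree t {n} A =
  Σ ℕ λ m → Σ (Fin m → Fin m → Set) λ B → IsTTree t B ×
  Σ (Fin n → Fin m) λ f → Injective _≡_ _≡_ f × (∀ u v → A u v → B (f u) (f v))

IsBipartite : ∀ {n} → Graph n → Set
IsBipartite {n} G = Σ (Fin n → Bool) λ c → ∀ u v → Adj G u v → c u ≢ c v

------------------------------------------------------------------------
-- Signed graphs, given by a signed edge relation E u v s
-- ("uv is an edge of sign s"), read undirectedly.

SRel : Set → Set₁
SRel V = V → V → Sign → Set

module _ {V : Set} (E : SRel V) where

  data Walk : V → V → Set where
    []   : ∀ {u} → Walk u u
    step : ∀ {u v w} (s : Sign) → (E u v s ⊎ E v u s) → Walk v w → Walk u w

  len : ∀ {u v} → Walk u v → ℕ
  len []             = 0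
  len (step _ _ W)   = suc (len W)

  wsign : ∀ {u v} → Walk u v → Sign
  wsign []           = S.+
  wsign (step s _ W) = s S.* wsign W

  -- vertices visited after the start vertex
  tailVerts : ∀ {u v} → Walk u v → List V
  tailVerts []                  = []
  tailVerts (step {v = v} _ _ W) = v ∷ tailVerts W

  -- a cycle: closed walk of length ≥ 3 with no repeated vertex
  IsCycle : ∀ {u} → Walk u u → Set
  IsCycle W = 3 ≤ len W × Unique (tailVerts W)

  -- unbalanced girth ≥ g
  UGirth≥ : ℕ → Set
  UGirth≥ g = ∀ u (W : Walk u u) → IsCycle W → wsign W ≡ S.- → g ≤ len W

  -- unbalanced girth = g
  UGirth≡ : ℕ → Set
  UGirth≡ g = UGirth≥ g ×
    Σ V λ u → Σ (Walk u u) λ W → IsCycle W × wsign W ≡ S.- × len W ≡ g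

  -- d is the (finite) graph distance between u and v
  IsDist : V → V → ℕ → Set
  IsDist u v d = (Σ (Walk u v) λ W → len W ≡ d) × (∀ (W : Walk u v) → d ≤ len W)

  -- a is the algebraic distance between u and v
  IsAlgDist : V → V → ℤ → Set
  IsAlgDist u v a = Σ ℕ λ d → IsDist u v d ×
    ( ((Σ (Walk u v) λ W → len W ≡ d × wsign W ≡ S.+) × a ≡ ℤ.+ d)
    ⊎ ((¬ Σ (Walk u v) λ W → len W ≡ d × wsign W ≡ S.+) × a ≡ ℤ.- (ℤ.+ d)))

-- the signed graph (G, σ)
signedRel : ∀ {n} → Graph n → (Fin n → Fin n → Sign) → SRel (Fin n)
signedRel G σ u v s = Adj G u v × σ u v ≡ s

------------------------------------------------------------------------
-- Signed edge-weighted graphs (K, w) on Fin m and the construction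
-- overline-overline (K,w)_{-2k}.

data CV (m : ℕ) : Set where
  orig  : Fin m → CV m
  -- internal vertex number p of the path of kind b replacing edge xy
  inner : Fin m → Fin m → Bool → ℕ → CV m

-- kind true: path of length |w| with the sign of w;
-- kind false: path of length 2k - |w| with the opposite sign
plen : ℕ → ℤ → Bool → ℕ
plen k w true  = ∣ w ∣
plen k w false = (2 ℕ.* k) ∸ ∣ w ∣

psign : ℤ → Bool → Sign
psign w true  = ℤ.sign w
psign w false = S.opposite (ℤ.sign w)

-- the p-th vertex of the path (0 = x, L = y)
pt : ∀ {m} → Fin m → Fin m → Bool → ℕ → ℕ → CV m
pt x y b L p = if p ≡ᵇ 0 then orig x else (if p ≡ᵇ L then orig y else inner x y b p)

-- edges of the construction; the sign of each path is carried by its first edge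
data ConsEdge (k : ℕ) {m : ℕ} (KAdj : Fin m → Fin m → Set) (w : Fin m → Fin m → ℤ)
     : SRel (CV m) where
  ce : (x y : Fin m) → x F.< y → KAdj x y → (b : Bool) → (p : ℕ) →
       suc p ≤ plen k (w x y) b →
       ConsEdge k KAdj w
         (pt x y b (plen k (w x y) b) p)
         (pt x y b (plen k (w x y) b) (suc p))
         (if p ≡ᵇ 0 then psign (w x y) b else S.+)

-- (K, w) is 2k-wide (notation only defined when 1 ≤ |w(e)| ≤ k)
IsWide : (k : ℕ) → ∀ {m} → (Fin m → Fin m → Set) → (Fin m → Fin m → ℤ) → Set
IsWide k KAdj w =
  (∀ x y → KAdj x y → 1 ≤ ∣ w x y ∣ × ∣ w x y ∣ ≤ k) ×
  UGirth≡ (ConsEdge k KAdj w) (2 ℕ.* k)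

------------------------------------------------------------------------
-- The weight w on E(H) of the lemma, as a specification of its value on uv

WeightSpec : ∀ {n} → ℕ → Graph n → (Fin n → Fin n → Sign) → Fin n → Fin n → ℤ → Set
WeightSpec k G σ u v a = Σ ℕ λ d → IsDist (signedRel G σ) u v d ×
  ( (d ≤ k × IsAlgDist (signedRel G σ) u v a)
  ⊎ (k < d × d % 2 ≡ k % 2 × a ≡ ℤ.+ k)
  ⊎ (k < d × d % 2 ≡ (k ∸ 1) % 2 × a ≡ ℤ.+ (k ∸ 1)))

{-# OPTIONS --safe #-}

-- Around any three vertices of the clique the weights satisfy ∣a∣, ∣b∣, ∣c∣ ≤ k, the triangle
-- inequalities, and ∣a∣ + ∣b∣ + ∣c∣ ≥ 2k when the product of their signs is negative: near weights
-- are read off shortest walks of G, whose negative closed walks have length ≥ 2k, and far weights are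
-- at least k - 1 and have the parity of the distance, which sums to an even number around a triangle
-- because G is bipartite. These inequalities say that, seen from a root r, the length of the
-- replacement path of a given sign between r and z is a signed 1-Lipschitz potential on the
-- construction; a negative closed walk passes through some original vertex r, where this potential is
-- 0 for the sign + and 2k for the sign -, so it has length ≥ 2k. The two paths replacing one edge form
-- a negative cycle of length exactly 2k.

module Submission where

import Data.Sign.Properties as SignP

open import Defs

open import Algebra.Solver.CommutativeMonoid SignP.*-commutativeMonoid using (prove; var; _⊕_)
open import Data.Bool using (Bool; true; false; if_then_else_; T)
open import Data.Empty using (⊥-elim)
open import Data.Fin as F using (Fin)
import Data.Fin.Properties as FinP
open import Data.Integer as ℤ using (ℤ; ∣_∣)
open import Data.List using ([]; _∷_)
open import Data.List.Membership.Propositional using (_∈_)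
import Data.List.Membership.DecPropositional as DecMembership
open import Data.List.Relation.Unary.All as All using (All; []; _∷_)
open import Data.List.Relation.Unary.All.Properties using (¬Any⇒All¬)
open import Data.List.Relation.Unary.AllPairs using ([]; _∷_)
open import Data.List.Relation.Unary.Any using (here; there)
open import Data.List.Relation.Unary.Unique.Propositional using (Unique)
open import Data.Nat using (ℕ; zero; suc; _+_; _*_; _≤_; _<_; _∸_; _⊓_; _%_; _≡ᵇ_; z≤n; s≤s; s≤s⁻¹; parity)
open import Data.Nat.Induction using (<-wellFounded)
open import Data.Nat.Properties
open import Data.Parity as ℙ using (Parity; 0ℙ; 1ℙ)
import Data.Parity.Properties as ParityP
open import Data.Product using (Σ; _×_; _,_; proj₁; proj₂)
open import Data.Sign as S using (Sign)
open import Data.Sum using (_⊎_; inj₁; inj₂; swap)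
open import Data.Unit using (⊤; tt)
open import Data.Vec using ([]; _∷_)
open import Function.Definitions using (Injective)
open import Induction.WellFounded using (Acc; acc)
open import Relation.Binary.Definitions using (DecidableEquality; tri<; tri≈; tri>)
open import Relation.Binary.PropositionalEquality
open import Relation.Nullary using (¬_; yes; no)

sign-left-comm : ∀ a b c → a S.* (b S.* c) ≡ b S.* (a S.* c)
sign-left-comm a b c = trans (sym (SignP.*-assoc a b c))
  (trans (cong (S._* c) (SignP.*-comm a b)) (SignP.*-assoc b a c))

sign-cancelʳ : ∀ s t → s S.* t S.* t ≡ s
sign-cancelʳ s t = trans (SignP.*-assoc s t t) (trans (cong (s S.*_) (SignP.s*s≡+ t)) (SignP.*-identityʳ s))

sign-rearrange : ∀ a b c x u → a S.* b S.* c S.* (a S.* x) S.* u ≡ c S.* (x S.* (b S.* u))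
sign-rearrange a b c x u = trans
  (prove 5 ((((A ⊕ B) ⊕ C) ⊕ (A ⊕ X)) ⊕ U) ((A ⊕ A) ⊕ (C ⊕ (X ⊕ (B ⊕ U)))) (a ∷ b ∷ c ∷ x ∷ u ∷ []))
  (cong (S._* (c S.* (x S.* (b S.* u)))) (SignP.s*s≡+ a))
  where
    A = var F.zero
    B = var (F.suc F.zero)
    C = var (F.suc (F.suc F.zero))
    X = var (F.suc (F.suc (F.suc F.zero)))
    U = var (F.suc (F.suc (F.suc (F.suc F.zero))))

digon-positive : ∀ s → s S.* (s S.* S.+) ≢ S.-
digon-positive S.+ ()
digon-positive S.- ()

+-rotate : ∀ x y z → x + y + z ≡ z + x + y
+-rotate x y z = trans (+-comm (x + y) z) (sym (+-assoc z x y))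

2k≡k+k : ∀ k → 2 * k ≡ k + k
2k≡k+k k = cong (k +_) (+-identityʳ k)

k≤2k : ∀ {k} → k ≤ 2 * k
k≤2k {k} = m≤m+n k _

k≤2k∸a : ∀ {k a} → a ≤ k → k ≤ 2 * k ∸ a
k≤2k∸a {k} {a} a≤k = begin
  k          ≡⟨ +-identityʳ k ⟨
  k + 0      ≡⟨ m+n∸m≡n k (k + 0) ⟨
  2 * k ∸ k  ≤⟨ ∸-monoʳ-≤ (2 * k) a≤k ⟩
  2 * k ∸ a  ∎
  where open ≤-Reasoning

2k≤[2k∸a]+[2k∸b] : ∀ {k a b} → a ≤ k → b ≤ k → 2 * k ≤ (2 * k ∸ a) + (2 * k ∸ b)
2k≤[2k∸a]+[2k∸b] {k} {a} {b} a≤k b≤k =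
  subst (_≤ (2 * k ∸ a) + (2 * k ∸ b)) (sym (2k≡k+k k)) (+-mono-≤ (k≤2k∸a a≤k) (k≤2k∸a b≤k))

k∸z≤y+[k∸x] : ∀ {k x y z} → x ≤ k → x ≤ y + z → k ∸ z ≤ y + (k ∸ x)
k∸z≤y+[k∸x] {k} {x} {y} {z} x≤k x≤y+z = m≤n+o⇒m∸n≤o k z (begin
  k                  ≡⟨ m+[n∸m]≡n x≤k ⟨
  x + (k ∸ x)        ≤⟨ +-monoˡ-≤ (k ∸ x) x≤y+z ⟩
  y + z + (k ∸ x)    ≡⟨ cong (_+ (k ∸ x)) (+-comm y z) ⟩
  z + y + (k ∸ x)    ≡⟨ +-assoc z y (k ∸ x) ⟩
  z + (y + (k ∸ x))  ∎)
  where open ≤-Reasoning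

min-lipschitz : ∀ {a b a′ b′} → a′ ≤ a + 1 → b′ ≤ b + 1 → a′ ⊓ b′ ≤ a ⊓ b + 1
min-lipschitz {a} {b} a′≤ b′≤ = ≤-trans (⊓-mono-≤ a′≤ b′≤) (≤-reflexive (sym (+-distribʳ-⊓ 1 a b)))

even-≤-suc : ∀ {m n} → parity m ≡ 0ℙ → parity n ≡ 0ℙ → m ≤ suc n → m ≤ n
even-≤-suc {m} {n} m-even n-even m≤1+n with m≤n⇒m<n∨m≡n m≤1+n
... | inj₁ m<1+n = s≤s⁻¹ m<1+n
... | inj₂ refl with trans (sym m-even) (trans (ParityP.+-homo-+ 1 n) (cong (1ℙ ℙ.+_) n-even))
...   | ()

parity-mod2 : ∀ n → parity (n % 2) ≡ parity n
parity-mod2 zero          = refl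
parity-mod2 (suc zero)    = refl
parity-mod2 (suc (suc n)) = parity-mod2 n

mod2⇒parity : ∀ {m n} → m % 2 ≡ n % 2 → parity m ≡ parity n
mod2⇒parity {m} {n} eq = trans (sym (parity-mod2 m)) (trans (cong parity eq) (parity-mod2 n))

parity-+₃ : ∀ x y z → parity (x + y + z) ≡ parity x ℙ.+ parity y ℙ.+ parity z
parity-+₃ x y z = trans (ParityP.+-homo-+ (x + y) z) (cong (ℙ._+ parity z) (ParityP.+-homo-+ x y))

-- Two weights in {k - 1, k} plus a positive one already reach 2k - 1; evenness adds the last unit.
far-far-long : ∀ {k x y N} → k ≤ suc x → k ≤ suc y → suc (x + y) ≤ N → parity N ≡ 0ℙ → 2 * k ≤ N
far-far-long {k} {x} {y} {N} k≤1+x k≤1+y 1+x+y≤N N-even =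
  even-≤-suc (ParityP.*-homo-* 2 k) N-even (begin
    2 * k              ≡⟨ 2k≡k+k k ⟩
    k + k              ≤⟨ +-mono-≤ k≤1+x k≤1+y ⟩
    suc x + suc y      ≡⟨ cong suc (+-suc x y) ⟩
    suc (suc (x + y))  ≤⟨ s≤s 1+x+y≤N ⟩
    suc N              ∎)
  where open ≤-Reasoning

module _ {V : Set} {E : SRel V} where

  infixr 5 _++ʷ_

  _++ʷ_ : ∀ {u v w} → Walk E u v → Walk E v w → Walk E u w
  []         ++ʷ Q = Q
  step s e P ++ʷ Q = step s e (P ++ʷ Q)

  len-++ʷ : ∀ {u v w} (P : Walk E u v) (Q : Walk E v w) →
            len E (P ++ʷ Q) ≡ len E P + len E Q
  len-++ʷ []           Q = refl
  len-++ʷ (step s e P) Q = cong suc (len-++ʷ P Q)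

  wsign-++ʷ : ∀ {u v w} (P : Walk E u v) (Q : Walk E v w) →
              wsign E (P ++ʷ Q) ≡ wsign E P S.* wsign E Q
  wsign-++ʷ []           Q = refl
  wsign-++ʷ (step s e P) Q =
    trans (cong (s S.*_) (wsign-++ʷ P Q)) (sym (SignP.*-assoc s (wsign E P) (wsign E Q)))

  len-++ʷ₃ : ∀ {u v w x} (P : Walk E u v) (Q : Walk E v w) (R : Walk E w x) →
             len E (P ++ʷ Q ++ʷ R) ≡ len E P + len E Q + len E R
  len-++ʷ₃ P Q R = trans (len-++ʷ P _) (trans (cong (len E P +_) (len-++ʷ Q R)) (sym (+-assoc (len E P) _ _)))

  wsign-++ʷ₃ : ∀ {u v w x} (P : Walk E u v) (Q : Walk E v w) (R : Walk E w x) →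
               wsign E (P ++ʷ Q ++ʷ R) ≡ wsign E P S.* wsign E Q S.* wsign E R
  wsign-++ʷ₃ P Q R = trans (wsign-++ʷ P _)
    (trans (cong (wsign E P S.*_) (wsign-++ʷ Q R)) (sym (SignP.*-assoc (wsign E P) _ _)))

  reverseʷ : ∀ {u v} → Walk E u v → Walk E v u
  reverseʷ []           = []
  reverseʷ (step s e P) = reverseʷ P ++ʷ step s (swap e) []

  len-reverseʷ : ∀ {u v} (P : Walk E u v) → len E (reverseʷ P) ≡ len E P
  len-reverseʷ []           = refl
  len-reverseʷ (step s e P) =
    trans (len-++ʷ (reverseʷ P) _) (trans (+-comm _ 1) (cong suc (len-reverseʷ P)))

  wsign-reverseʷ : ∀ {u v} (P : Walk E u v) → wsign E (reverseʷ P) ≡ wsign E P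
  wsign-reverseʷ []           = refl
  wsign-reverseʷ (step s e P) = begin
    wsign E (reverseʷ P ++ʷ step s (swap e) [])  ≡⟨ wsign-++ʷ (reverseʷ P) _ ⟩
    wsign E (reverseʷ P) S.* (s S.* S.+)         ≡⟨ cong₂ S._*_ (wsign-reverseʷ P) (SignP.*-identityʳ s) ⟩
    wsign E P S.* s                              ≡⟨ SignP.*-comm (wsign E P) s ⟩
    s S.* wsign E P                              ∎
    where open ≡-Reasoning

  split-at : ∀ {u v x} (P : Walk E u v) → x ∈ tailVerts E P →
             Σ (Walk E u x) λ P₁ → Σ (Walk E x v) λ P₂ → 1 ≤ len E P₁ × P₁ ++ʷ P₂ ≡ P
  split-at (step s e P) (here refl) = step s e [] , P , s≤s z≤n , refl
  split-at (step s e P) (there x∈P) with split-at P x∈P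
  ... | P₁ , P₂ , _ , refl = step s e P₁ , P₂ , s≤s z≤n , refl

  -- A walk revisiting a vertex contains a closed subwalk C; cutting it out leaves R.
  record Shortcut {u v} (P : Walk E u v) : Set where
    field
      {x}    : V
      C      : Walk E x x
      R      : Walk E u v
      C≥1    : 1 ≤ len E C
      C<P    : len E C < len E P
      len≡   : len E C + len E R ≡ len E P
      wsign≡ : wsign E P ≡ wsign E C S.* wsign E R

  module _ (_≟_ : DecidableEquality V) where
    open DecMembership _≟_ using (_∈?_)

    path-or-shortcut : ∀ {u v} (P : Walk E u v) → Unique (tailVerts E P) ⊎ Shortcut P
    path-or-shortcut [] = inj₁ []
    path-or-shortcut (step {v = x} s e P) with x ∈? tailVerts E P
    ... | yes x∈P with split-at P x∈P
    ...   | P₁ , P₂ , P₁≥1 , refl = inj₂ record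
      { C      = P₁
      ; R      = step s e P₂
      ; C≥1    = P₁≥1
      ; C<P    = s≤s (subst (len E P₁ ≤_) (sym (len-++ʷ P₁ P₂)) (m≤m+n _ _))
      ; len≡   = trans (+-suc _ _) (cong suc (sym (len-++ʷ P₁ P₂)))
      ; wsign≡ = trans (cong (s S.*_) (wsign-++ʷ P₁ P₂)) (sign-left-comm s (wsign E P₁) (wsign E P₂))
      }
    path-or-shortcut (step s e P) | no x∉P with path-or-shortcut P
    ... | inj₁ unique = inj₁ (¬Any⇒All¬ _ x∉P ∷ unique)
    ... | inj₂ cut = inj₂ record
      { C      = C
      ; R      = step s e R
      ; C≥1    = C≥1
      ; C<P    = m≤n⇒m≤1+n C<P
      ; len≡   = trans (+-suc _ _) (cong suc len≡)
      ; wsign≡ = trans (cong (s S.*_) wsign≡) (sign-left-comm s (wsign E C) (wsign E R))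
      }
      where open Shortcut cut

    -- Cutting a shortcut splits a closed walk into two shorter closed walks, one of them negative.
    negative-closed-walk-long : ∀ {g} → (∀ {u s} → ¬ E u u s) →
      (∀ {u v s t} → E u v s ⊎ E v u s → E u v t ⊎ E v u t → s ≡ t) →
      UGirth≥ E g → ∀ {u} (W : Walk E u u) → wsign E W ≡ S.- → g ≤ len E W
    negative-closed-walk-long {g} loopless single-signed girth W = go W (<-wellFounded _)
      where
        go : ∀ {u} (W : Walk E u u) → Acc _<_ (len E W) → wsign E W ≡ S.- → g ≤ len E W
        go (step s (inj₁ e) []) _ _ = ⊥-elim (loopless e)
        go (step s (inj₂ e) []) _ _ = ⊥-elim (loopless e)
        go (step s e (step t e′ [])) _ negative with single-signed e (swap e′)
        ... | refl = ⊥-elim (digon-positive s negative)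
        go W@(step _ _ (step _ _ (step _ _ _))) (acc smaller) negative with path-or-shortcut W
        ... | inj₁ unique = girth _ W (s≤s (s≤s (s≤s z≤n)) , unique) negative
        ... | inj₂ cut with wsign E (Shortcut.C cut) in C-sign
        ...   | S.- = ≤-trans (go C (smaller C<P) C-sign) (<⇒≤ C<P)
          where open Shortcut cut
        ...   | S.+ = ≤-trans (go R (smaller R<W) R-negative) (subst (len E R ≤_) len≡ (m≤n+m _ _))
          where
            open Shortcut cut
            R<W : len E R < len E W
            R<W = subst (len E R <_) len≡ (+-monoˡ-≤ (len E R) C≥1)
            R-negative : wsign E R ≡ S.-
            R-negative = trans (sym (trans wsign≡ (cong (S._* wsign E R) C-sign))) negative

  SignLipschitz : (V → Sign → ℕ) → Set
  SignLipschitz F = ∀ {u v s} → E u v s → ∀ τ → F v (τ S.* s) ≤ F u τ + 1 × F u (τ S.* s) ≤ F v τ + 1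

  walk-lipschitz : ∀ {F} → SignLipschitz F → ∀ {u v} (P : Walk E u v) τ →
                   F v (τ S.* wsign E P) ≤ F u τ + len E P
  walk-lipschitz {F} lip {u} [] τ = ≤-trans (≤-reflexive (cong (F u) (SignP.*-identityʳ τ))) (m≤m+n _ 0)
  walk-lipschitz {F} lip {u} {v} (step {v = x} s e P) τ = begin
    F v (τ S.* (s S.* wsign E P))  ≡⟨ cong (F v) (sym (SignP.*-assoc τ s (wsign E P))) ⟩
    F v (τ S.* s S.* wsign E P)    ≤⟨ walk-lipschitz lip P (τ S.* s) ⟩
    F x (τ S.* s) + len E P        ≤⟨ +-monoˡ-≤ (len E P) (edge e) ⟩
    F u τ + 1 + len E P            ≡⟨ +-assoc (F u τ) 1 (len E P) ⟩
    F u τ + suc (len E P)          ∎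
    where
      open ≤-Reasoning
      edge : E u x s ⊎ E x u s → F x (τ S.* s) ≤ F u τ + 1
      edge (inj₁ e) = proj₁ (lip e τ)
      edge (inj₂ e) = proj₂ (lip e τ)

  lipschitz-closed-walk : ∀ {F} → SignLipschitz F → ∀ {u} (W : Walk E u u) → wsign E W ≡ S.- →
                          F u S.- ≤ F u S.+ + len E W
  lipschitz-closed-walk {F} lip {u} W negative =
    subst (λ s → F u s ≤ F u S.+ + len E W) negative (walk-lipschitz lip W S.+)

  Ascending : (V → ℕ) → ∀ {u v} → Walk E u v → Set
  Ascending κ []                           = ⊤
  Ascending κ (step {u = u} {v = v} _ _ P) = κ u < κ v × Ascending κ P

  ascending-++ʷ : ∀ κ {u v w} (P : Walk E u v) (Q : Walk E v w) →
                  Ascending κ P → Ascending κ Q → Ascending κ (P ++ʷ Q)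
  ascending-++ʷ κ []           Q _           asc = asc
  ascending-++ʷ κ (step s e P) Q (lt , ascP) ascQ = lt , ascending-++ʷ κ P Q ascP ascQ

  ascending-above : ∀ κ {u v} (P : Walk E u v) → Ascending κ P → All (λ x → κ u < κ x) (tailVerts E P)
  ascending-above κ []           _          = []
  ascending-above κ (step s e P) (lt , asc) = lt ∷ All.map (<-trans lt) (ascending-above κ P asc)

  ascending⇒unique : ∀ κ {u v} (P : Walk E u v) → Ascending κ P → Unique (u ∷ tailVerts E P)
  ascending⇒unique κ []           _          = [] ∷ []
  ascending⇒unique κ (step s e P) (lt , asc) =
    All.map (λ above eq → <-irrefl (cong κ eq) above) (ascending-above κ (step s e P) (lt , asc))
    ∷ ascending⇒unique κ P asc

-- arc k A ρ is the length of the path of sign ρ·sign(a) that replaces an edge of weight a, |a| = A.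
arc : ℕ → ℕ → Sign → ℕ
arc k A S.+ = A
arc k A S.- = 2 * k ∸ A

-- The conditions on the absolute values and sign product of the weights that make a triangle 2k-wide.
record WideTriangle (k A B C : ℕ) (ε : Sign) : Set where
  field
    A≤k     : A ≤ k
    B≤k     : B ≤ k
    C≤k     : C ≤ k
    A≤B+C   : A ≤ B + C
    B≤A+C   : B ≤ A + C
    C≤A+B   : C ≤ A + B
    negative⇒long : ε ≡ S.- → 2 * k ≤ A + B + C

module _ {k : ℕ} where

  open WideTriangle

  arc-triangle : ∀ {A B C ε} → WideTriangle k A B C ε → ∀ ρ₁ ρ₂ →
                 arc k C (ε S.* ρ₁ S.* ρ₂) ≤ arc k A ρ₁ + arc k B ρ₂
  arc-triangle {ε = S.+} t S.+ S.+ = C≤A+B t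
  arc-triangle {ε = S.+} t S.+ S.- = k∸z≤y+[k∸x] (≤-trans (B≤k t) k≤2k) (B≤A+C t)
  arc-triangle {A} {B} {C} {S.+} t S.- S.+ =
    subst (2 * k ∸ C ≤_) (+-comm B (2 * k ∸ A)) (k∸z≤y+[k∸x] (≤-trans (A≤k t) k≤2k) (A≤B+C t))
  arc-triangle {ε = S.+} t S.- S.- = ≤-trans (≤-trans (C≤k t) k≤2k) (2k≤[2k∸a]+[2k∸b] (A≤k t) (B≤k t))
  arc-triangle {A} {B} {C} {S.-} t S.+ S.+ =
    m≤n+o⇒m∸n≤o (2 * k) C (subst (2 * k ≤_) (+-comm (A + B) C) (negative⇒long t refl))
  arc-triangle {A} {ε = S.-} t S.+ S.- = ≤-trans (C≤k t) (≤-trans (k≤2k∸a (B≤k t)) (m≤n+m _ A))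
  arc-triangle {B = B} {ε = S.-} t S.- S.+ = ≤-trans (C≤k t) (≤-trans (k≤2k∸a (A≤k t)) (m≤m+n _ B))
  arc-triangle {C = C} {ε = S.-} t S.- S.- = ≤-trans (m∸n≤m _ C) (2k≤[2k∸a]+[2k∸b] (A≤k t) (B≤k t))

  isosceles-wide : ∀ {B ε} → B ≤ k → ε ≡ S.+ → WideTriangle k 0 B B ε
  isosceles-wide {B} B≤k ε≡+ = record
    { A≤k = z≤n ; B≤k = B≤k ; C≤k = B≤k
    ; A≤B+C = z≤n ; B≤A+C = ≤-refl ; C≤A+B = ≤-refl
    ; negative⇒long = λ ε≡- → ⊥-elim (SignP.s≢opposite[s] S.+ (trans (sym ε≡+) ε≡-))
    }

  wide-rotate : ∀ {A B C ε} → WideTriangle k A B C ε → WideTriangle k B C A ε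
  wide-rotate {A} {B} {C} t = record
    { A≤k = B≤k t ; B≤k = C≤k t ; C≤k = A≤k t
    ; A≤B+C = subst (B ≤_) (+-comm A C) (B≤A+C t)
    ; B≤A+C = subst (C ≤_) (+-comm A B) (C≤A+B t)
    ; C≤A+B = A≤B+C t
    ; negative⇒long = λ ε≡- → subst (2 * k ≤_) (sym (+-rotate B C A)) (negative⇒long t ε≡-)
    }

kindSign : Bool → Sign
kindSign true  = S.+
kindSign false = S.-

psign≡ : ∀ a b → psign a b ≡ ℤ.sign a S.* kindSign b
psign≡ a true  = sym (SignP.*-identityʳ (ℤ.sign a))
psign≡ a false with ℤ.sign a
... | S.+ = refl
... | S.- = refl

plen≡arc : ∀ k a b → plen k a b ≡ arc k ∣ a ∣ (kindSign b)
plen≡arc k a true  = refl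
plen≡arc k a false = refl

module SignedBipartite {n} (G : Graph n) (σ : Fin n → Fin n → Sign)
    (σ-sym : ∀ u v → σ u v ≡ σ v u) (bipartite : IsBipartite G) where

  E : SRel (Fin n)
  E = signedRel G σ

  loopless : ∀ {u s} → ¬ E u u s
  loopless (adj , _) = Adj-irrefl G adj

  single-signed : ∀ {u v s t} → E u v s ⊎ E v u s → E u v t ⊎ E v u t → s ≡ t
  single-signed e e′ = trans (sym (σ≡ e)) (σ≡ e′)
    where
      σ≡ : ∀ {u v s} → E u v s ⊎ E v u s → σ u v ≡ s
      σ≡ (inj₁ (_ , eq))       = eq
      σ≡ {u} {v} (inj₂ (_ , eq)) = trans (σ-sym u v) eq

  colour : Fin n → Parity
  colour u = if proj₁ bipartite u then 1ℙ else 0ℙ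

  edge-flips-colour : ∀ {u v s} → E u v s ⊎ E v u s → colour v ≡ 1ℙ ℙ.+ colour u
  edge-flips-colour {u} {v} e = flips (proj₂ bipartite u v (adjacent e))
    where
      adjacent : E u v _ ⊎ E v u _ → Adj G u v
      adjacent (inj₁ (adj , _)) = adj
      adjacent (inj₂ (adj , _)) = Adj-sym G adj
      flips : ∀ {a b} → a ≢ b → (if b then 1ℙ else 0ℙ) ≡ 1ℙ ℙ.+ (if a then 1ℙ else 0ℙ)
      flips {true}  {true}  a≢b = ⊥-elim (a≢b refl)
      flips {true}  {false} _   = refl
      flips {false} {true}  _   = refl
      flips {false} {false} a≢b = ⊥-elim (a≢b refl)

  walk-colour : ∀ {u v} (P : Walk E u v) → colour v ≡ colour u ℙ.+ parity (len E P)
  walk-colour {u} [] = sym (ParityP.+-identityʳ (colour u))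
  walk-colour {u} {v} (step {v = x} s e P) = begin
    colour v                                ≡⟨ walk-colour P ⟩
    colour x ℙ.+ parity (len E P)           ≡⟨ cong (ℙ._+ parity (len E P)) (edge-flips-colour e) ⟩
    1ℙ ℙ.+ colour u ℙ.+ parity (len E P)    ≡⟨ cong (ℙ._+ parity (len E P)) (ParityP.+-comm 1ℙ (colour u)) ⟩
    colour u ℙ.+ 1ℙ ℙ.+ parity (len E P)    ≡⟨ ParityP.+-assoc (colour u) 1ℙ (parity (len E P)) ⟩
    colour u ℙ.+ (1ℙ ℙ.+ parity (len E P))  ≡⟨ cong (colour u ℙ.+_) (sym (ParityP.+-homo-+ 1 (len E P))) ⟩
    colour u ℙ.+ parity (suc (len E P))     ∎
    where open ≡-Reasoning

  closed-walk-even : ∀ {u} (W : Walk E u u) → parity (len E W) ≡ 0ℙ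
  closed-walk-even {u} W =
    ParityP.+-cancelˡ-≡ (colour u) _ _ (trans (sym (walk-colour W)) (sym (ParityP.+-identityʳ (colour u))))

  dist-sym : ∀ {u v d} → IsDist E u v d → IsDist E v u d
  dist-sym ((P , P≡d) , shortest) =
    (reverseʷ P , trans (len-reverseʷ P) P≡d) ,
    λ Q → subst (_ ≤_) (len-reverseʷ Q) (shortest (reverseʷ Q))

  dist-unique : ∀ {u v d d′} → IsDist E u v d → IsDist E u v d′ → d ≡ d′
  dist-unique ((P , P≡d) , shortest) ((P′ , P′≡d′) , shortest′) =
    ≤-antisym (subst (_ ≤_) P′≡d′ (shortest P′)) (subst (_ ≤_) P≡d (shortest′ P))

  dist-triangle : ∀ {u v w d₁ d₂ d₃} → IsDist E u v d₁ → IsDist E v w d₂ → IsDist E u w d₃ →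
                  d₃ ≤ d₁ + d₂
  dist-triangle ((P , P≡d₁) , _) ((Q , Q≡d₂) , _) (_ , shortest) =
    subst (_ ≤_) (trans (len-++ʷ P Q) (cong₂ _+_ P≡d₁ Q≡d₂)) (shortest (P ++ʷ Q))

  dist-positive : ∀ {u v d} → u ≢ v → IsDist E u v d → 1 ≤ d
  dist-positive {d = suc _}  _   _                     = s≤s z≤n
  dist-positive {d = zero}   u≢v (([] , _) , _)         = ⊥-elim (u≢v refl)
  dist-positive {d = zero}   u≢v ((step _ _ _ , ()) , _)

  module Weights (k : ℕ) (2≤k : 2 ≤ k) (girth : UGirth≥ E (2 * k)) where

    -- near: d ≤ k and a is the algebraic distance; far: d > k and ∣ a ∣ ∈ {k - 1, k}.
    data Shape (u v : Fin n) (a : ℤ) (d : ℕ) : Set where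
      near : ∣ a ∣ ≡ d → (P : Walk E u v) → len E P ≡ d → wsign E P ≡ ℤ.sign a → Shape u v a d
      far  : k < d → k ≤ suc ∣ a ∣ → Shape u v a d

    record Admissible (u v : Fin n) (a : ℤ) : Set where
      field
        d       : ℕ
        isDist  : IsDist E u v d
        ∣a∣≥1   : 1 ≤ ∣ a ∣
        ∣a∣≤k   : ∣ a ∣ ≤ k
        parity≡ : parity ∣ a ∣ ≡ parity d
        shape   : Shape u v a d

    ∣a∣≤d : ∀ {u v a} (α : Admissible u v a) → ∣ a ∣ ≤ Admissible.d α
    ∣a∣≤d α with Admissible.shape α
    ... | near ∣a∣≡d _ _ _ = ≤-reflexive ∣a∣≡d
    ... | far k<d _        = ≤-trans (Admissible.∣a∣≤k α) (<⇒≤ k<d)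

    admissible-reverse : ∀ {u v a} → Admissible u v a → Admissible v u a
    admissible-reverse α = record
      { d = d ; isDist = dist-sym isDist ; ∣a∣≥1 = ∣a∣≥1 ; ∣a∣≤k = ∣a∣≤k ; parity≡ = parity≡
      ; shape = reverse-shape shape
      }
      where
        open Admissible α
        reverse-shape : ∀ {u v a d} → Shape u v a d → Shape v u a d
        reverse-shape (near ∣a∣≡d P P≡d sign≡) =
          near ∣a∣≡d (reverseʷ P) (trans (len-reverseʷ P) P≡d) (trans (wsign-reverseʷ P) sign≡)
        reverse-shape (far k<d k≤1+∣a∣) = far k<d k≤1+∣a∣

    weightSpec⇒admissible : ∀ {u v a} → u ≢ v → WeightSpec k G σ u v a → Admissible u v a
    weightSpec⇒admissible u≢v (zero , dist , inj₁ _) with dist-positive u≢v dist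
    ... | ()
    weightSpec⇒admissible {u} {v} u≢v (d@(suc _) , dist , inj₁ (d≤k , d′ , dist′ , algDist))
      with dist-unique dist dist′
    ... | refl = from-algDist algDist
      where
        PositiveShortest = Σ (Walk E u v) λ P → len E P ≡ d × wsign E P ≡ S.+
        from-algDist : ∀ {a} → (PositiveShortest × a ≡ ℤ.+ d) ⊎ (¬ PositiveShortest × a ≡ ℤ.- (ℤ.+ d)) →
                       Admissible u v a
        from-algDist (inj₁ ((P , P≡d , P⁺) , refl)) = record
          { d = d ; isDist = dist ; ∣a∣≥1 = s≤s z≤n ; ∣a∣≤k = d≤k ; parity≡ = refl
          ; shape = near refl P P≡d P⁺ }
        from-algDist (inj₂ (no-positive , refl)) = record
          { d = d ; isDist = dist ; ∣a∣≥1 = s≤s z≤n ; ∣a∣≤k = d≤k ; parity≡ = refl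
          ; shape = near refl P P≡d negative }
          where
            P = proj₁ (proj₁ dist)
            P≡d = proj₂ (proj₁ dist)
            negative : wsign E P ≡ S.-
            negative with wsign E P in P-sign
            ... | S.- = refl
            ... | S.+ = ⊥-elim (no-positive (P , P≡d , P-sign))
    weightSpec⇒admissible u≢v (d , dist , inj₂ (inj₁ (k<d , d≡k , refl))) = record
      { d = d ; isDist = dist ; ∣a∣≥1 = ≤-trans (s≤s z≤n) 2≤k ; ∣a∣≤k = ≤-refl
      ; parity≡ = mod2⇒parity {k} {d} (sym d≡k) ; shape = far k<d (n≤1+n k) }
    weightSpec⇒admissible u≢v (d , dist , inj₂ (inj₂ (k<d , d≡k-1 , refl))) = record
      { d = d ; isDist = dist ; ∣a∣≥1 = ∸-monoˡ-≤ 1 2≤k ; ∣a∣≤k = m∸n≤m k 1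
      ; parity≡ = mod2⇒parity {k ∸ 1} {d} (sym d≡k-1) ; shape = far k<d (m≤n+m∸n k 1) }

    open Admissible

    dist-bound : ∀ {u v w a b c} (α : Admissible u v a) (β : Admissible v w b) (γ : Admissible w u c) →
                 d α ≤ d β + d γ
    dist-bound α β γ = dist-triangle (isDist β) (isDist γ) (dist-sym (isDist α))

    side-bound : ∀ {u v w a b c} → Admissible u v a → Admissible v w b → Admissible w u c →
                 ∣ a ∣ ≤ ∣ b ∣ + ∣ c ∣
    side-bound {a = a} {b} {c} α β γ with shape β | shape γ
    ... | near ∣b∣≡d _ _ _ | near ∣c∣≡d _ _ _ = begin
      ∣ a ∣          ≤⟨ ∣a∣≤d α ⟩
      d α            ≤⟨ dist-bound α β γ ⟩
      d β + d γ      ≡⟨ cong₂ _+_ ∣b∣≡d ∣c∣≡d ⟨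
      ∣ b ∣ + ∣ c ∣  ∎
      where open ≤-Reasoning
    ... | far _ k≤1+∣b∣ | _              = ≤-trans (∣a∣≤k α) (≤-trans k≤1+∣b∣ (m<m+n ∣ b ∣ (∣a∣≥1 γ)))
    ... | near _ _ _ _  | far _ k≤1+∣c∣ = ≤-trans (∣a∣≤k α) (≤-trans k≤1+∣c∣ (+-monoˡ-≤ ∣ c ∣ (∣a∣≥1 β)))

    triangle-even : ∀ {u v w a b c} → Admissible u v a → Admissible v w b → Admissible w u c →
                    parity (∣ a ∣ + ∣ b ∣ + ∣ c ∣) ≡ 0ℙ
    triangle-even {a = a} {b} {c} α β γ = begin
      parity (∣ a ∣ + ∣ b ∣ + ∣ c ∣)                   ≡⟨ parity-+₃ (∣ a ∣) (∣ b ∣) (∣ c ∣) ⟩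
      parity ∣ a ∣ ℙ.+ parity ∣ b ∣ ℙ.+ parity ∣ c ∣
        ≡⟨ cong₂ ℙ._+_ (cong₂ ℙ._+_ (parity≡ α) (parity≡ β)) (parity≡ γ) ⟩
      parity (d α) ℙ.+ parity (d β) ℙ.+ parity (d γ)   ≡⟨ parity-+₃ (d α) (d β) (d γ) ⟨
      parity (d α + d β + d γ)                         ≡⟨ cong parity len≡ ⟨
      parity (len E (P ++ʷ Q ++ʷ R))                   ≡⟨ closed-walk-even (P ++ʷ Q ++ʷ R) ⟩
      0ℙ                                               ∎
      where
        open ≡-Reasoning
        P = proj₁ (proj₁ (isDist α))
        Q = proj₁ (proj₁ (isDist β))
        R = proj₁ (proj₁ (isDist γ))
        len≡ : len E (P ++ʷ Q ++ʷ R) ≡ d α + d β + d γ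
        len≡ = trans (len-++ʷ₃ P Q R)
          (cong₂ _+_ (cong₂ _+_ (proj₂ (proj₁ (isDist α))) (proj₂ (proj₁ (isDist β)))) (proj₂ (proj₁ (isDist γ))))

    far-triangle-long : ∀ {u v w a b c} (α : Admissible u v a) → Admissible v w b → Admissible w u c →
                        k < d α → k ≤ suc ∣ a ∣ → 2 * k ≤ ∣ a ∣ + ∣ b ∣ + ∣ c ∣
    far-triangle-long {a = a} {b} {c} α β γ k<dα k≤1+∣a∣ with shape β | shape γ
    ... | near ∣b∣≡d _ _ _ | near ∣c∣≡d _ _ _ = s≤s⁻¹ (begin
      suc (2 * k)                    ≡⟨ cong suc (2k≡k+k k) ⟩
      suc (k + k)                    ≡⟨ +-suc k k ⟨
      k + suc k                      ≤⟨ +-mono-≤ k≤1+∣a∣ k<dα ⟩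
      suc ∣ a ∣ + d α                ≤⟨ +-monoʳ-≤ (suc ∣ a ∣) (dist-bound α β γ) ⟩
      suc ∣ a ∣ + (d β + d γ)        ≡⟨ cong (λ e → suc (∣ a ∣ + e)) (cong₂ _+_ ∣b∣≡d ∣c∣≡d) ⟨
      suc (∣ a ∣ + (∣ b ∣ + ∣ c ∣))  ≡⟨ cong suc (+-assoc (∣ a ∣) (∣ b ∣) (∣ c ∣)) ⟨
      suc (∣ a ∣ + ∣ b ∣ + ∣ c ∣)    ∎)
      where open ≤-Reasoning
    ... | far _ k≤1+∣b∣ | _ =
      far-far-long k≤1+∣a∣ k≤1+∣b∣ (m<m+n (∣ a ∣ + ∣ b ∣) (∣a∣≥1 γ)) (triangle-even α β γ)
    ... | near _ _ _ _ | far _ k≤1+∣c∣ =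
      far-far-long k≤1+∣a∣ k≤1+∣c∣ (+-monoˡ-≤ (∣ c ∣) (m<m+n (∣ a ∣) (∣a∣≥1 β))) (triangle-even α β γ)

    negative-triangle-long : ∀ {u v w a b c} → Admissible u v a → Admissible v w b → Admissible w u c →
      ℤ.sign a S.* ℤ.sign b S.* ℤ.sign c ≡ S.- → 2 * k ≤ ∣ a ∣ + ∣ b ∣ + ∣ c ∣
    negative-triangle-long {a = a} {b} {c} α β γ negative with shape α | shape β | shape γ
    ... | far k<d k≤1+∣a∣ | _ | _ = far-triangle-long α β γ k<d k≤1+∣a∣
    ... | near _ _ _ _ | far k<d k≤1+∣b∣ | _ =
      subst (2 * k ≤_) (+-rotate (∣ b ∣) (∣ c ∣) (∣ a ∣)) (far-triangle-long β γ α k<d k≤1+∣b∣)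
    ... | near _ _ _ _ | near _ _ _ _ | far k<d k≤1+∣c∣ =
      subst (2 * k ≤_) (trans (+-rotate (∣ c ∣) (∣ a ∣) (∣ b ∣)) (+-rotate (∣ b ∣) (∣ c ∣) (∣ a ∣)))
            (far-triangle-long γ α β k<d k≤1+∣c∣)
    ... | near ∣a∣≡d P P≡d P-sign | near ∣b∣≡d Q Q≡d Q-sign | near ∣c∣≡d R R≡d R-sign = begin
      2 * k                             ≤⟨ negative-closed-walk-long FinP._≟_ loopless single-signed girth
                                             (P ++ʷ Q ++ʷ R) (trans (wsign-++ʷ₃ P Q R) (trans sign≡ negative)) ⟩
      len E (P ++ʷ Q ++ʷ R)             ≡⟨ len-++ʷ₃ P Q R ⟩
      len E P + len E Q + len E R       ≡⟨ cong₂ _+_ (cong₂ _+_ (side P≡d ∣a∣≡d) (side Q≡d ∣b∣≡d)) (side R≡d ∣c∣≡d) ⟩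
      ∣ a ∣ + ∣ b ∣ + ∣ c ∣             ∎
      where
        open ≤-Reasoning
        side : ∀ {ℓ e δ} → ℓ ≡ δ → e ≡ δ → ℓ ≡ e
        side ℓ≡δ e≡δ = trans ℓ≡δ (sym e≡δ)
        sign≡ : wsign E P S.* wsign E Q S.* wsign E R ≡ ℤ.sign a S.* ℤ.sign b S.* ℤ.sign c
        sign≡ = cong₂ S._*_ (cong₂ S._*_ P-sign Q-sign) R-sign

    admissible-triangle-wide : ∀ {u v w a b c} → Admissible u v a → Admissible v w b → Admissible w u c →
      WideTriangle k (∣ a ∣) (∣ b ∣) (∣ c ∣) (ℤ.sign a S.* ℤ.sign b S.* ℤ.sign c)
    admissible-triangle-wide {a = a} {b} {c} α β γ = record
      { A≤k = ∣a∣≤k α ; B≤k = ∣a∣≤k β ; C≤k = ∣a∣≤k γ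
      ; A≤B+C = side-bound α β γ
      ; B≤A+C = subst (∣ b ∣ ≤_) (+-comm (∣ c ∣) (∣ a ∣)) (side-bound β γ α)
      ; C≤A+B = side-bound γ α β
      ; negative⇒long = negative-triangle-long α β γ
      }

module Construction (k : ℕ) {m : ℕ} (KAdj : Fin m → Fin m → Set) (w : Fin m → Fin m → ℤ) where

  CE : SRel (CV m)
  CE = ConsEdge k KAdj w

  pt-last : ∀ {x y b L} → 1 ≤ L → pt {m} x y b L L ≡ orig y
  pt-last {L = suc L} _ with suc L ≡ᵇ suc L | ≡⇒≡ᵇ (suc L) (suc L) refl
  ... | true | _ = refl

  pt-end : ∀ {x y b L p} → suc p ≡ L → pt {m} x y b L (suc p) ≡ orig y
  pt-end {x} {y} {b} {p = p} refl = pt-last {x} {y} {b} {suc p} (s≤s z≤n)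

  pt-inner : ∀ {x y b L p} → 1 ≤ p → p < L → pt {m} x y b L p ≡ inner x y b p
  pt-inner {L = L} {p = suc p} _ p<L with suc p ≡ᵇ L in eq
  ... | false = refl
  ... | true  = ⊥-elim (<⇒≢ p<L (≡ᵇ⇒≡ (suc p) L (subst T (sym eq) tt)))

  edgeSign : Fin m → Fin m → Bool → ℕ → Sign
  edgeSign x y b p = if p ≡ᵇ 0 then psign (w x y) b else S.+

  CompatibleAlong : (Fin m → Sign → ℕ) → Fin m → Fin m → Bool → Set
  CompatibleAlong Φ x y b = ∀ τ →
    Φ y (τ S.* psign (w x y) b) ≤ Φ x τ + plen k (w x y) b ×
    Φ x (τ S.* psign (w x y) b) ≤ Φ y τ + plen k (w x y) b

  Compatible : (Fin m → Sign → ℕ) → Set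
  Compatible Φ = ∀ x y → x F.< y → KAdj x y → ∀ b → CompatibleAlong Φ x y b

  interpolate : (Fin m → Sign → ℕ) → CV m → Sign → ℕ
  interpolate Φ (orig z)        τ = Φ z τ
  interpolate Φ (inner x y b p) τ = (Φ x (τ S.* psign (w x y) b) + p) ⊓ (Φ y τ + (plen k (w x y) b ∸ p))

  module Path (Φ : Fin m → Sign → ℕ) (x y : Fin m) (b : Bool) (compatible : CompatibleAlong Φ x y b) where

    L : ℕ
    L = plen k (w x y) b

    π : Sign
    π = psign (w x y) b

    along : ℕ → Sign → ℕ
    along p τ = (Φ x (τ S.* π) + p) ⊓ (Φ y τ + (L ∸ p))

    along-lipschitz : ∀ {p} → p < L → ∀ τ → along (suc p) τ ≤ along p τ + 1 × along p τ ≤ along (suc p) τ + 1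
    along-lipschitz {p} p<L τ =
      min-lipschitz (≤-reflexive (trans (+-suc _ p) (+-comm 1 _)))
                    (≤-trans (+-monoʳ-≤ (Φ y τ) (∸-monoʳ-≤ L (n≤1+n p))) (m≤m+n _ 1)) ,
      min-lipschitz (≤-trans (+-monoʳ-≤ (Φ x (τ S.* π)) (n≤1+n p)) (m≤m+n _ 1))
                    (≤-reflexive (trans (cong (Φ y τ +_) (trans (+-∸-assoc 1 p<L) (+-comm 1 _)))
                                        (sym (+-assoc (Φ y τ) _ 1))))

    interpolate-pt-suc : ∀ {p} → suc p ≤ L → ∀ τ → interpolate Φ (pt x y b L (suc p)) τ ≡ along (suc p) τ
    interpolate-pt-suc {p} 1+p≤L τ with m≤n⇒m<n∨m≡n 1+p≤L
    ... | inj₁ 1+p<L rewrite pt-inner {x} {y} {b} (s≤s z≤n) 1+p<L = refl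
    ... | inj₂ 1+p≡L rewrite pt-end {x} {y} {b} 1+p≡L =
      sym (trans (cong (λ r → (Φ x (τ S.* π) + suc p) ⊓ (Φ y τ + r)) L∸1+p≡0)
                 (trans (m≥n⇒m⊓n≡n y-side≤x-side) (+-identityʳ _)))
      where
        L∸1+p≡0 : L ∸ suc p ≡ 0
        L∸1+p≡0 = trans (cong (_∸ suc p) (sym 1+p≡L)) (n∸n≡0 (suc p))
        y-side≤x-side : Φ y τ + 0 ≤ Φ x (τ S.* π) + suc p
        y-side≤x-side = begin
          Φ y τ + 0                    ≡⟨ +-identityʳ _ ⟩
          Φ y τ                        ≡⟨ cong (Φ y) (sym (sign-cancelʳ τ π)) ⟩
          Φ y (τ S.* π S.* π)          ≤⟨ proj₁ (compatible (τ S.* π)) ⟩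
          Φ x (τ S.* π) + L            ≡⟨ cong (Φ x (τ S.* π) +_) (sym 1+p≡L) ⟩
          Φ x (τ S.* π) + suc p        ∎
          where open ≤-Reasoning

    -- Twisting τ by the sign of the edge leaving position p lets the end x fit the formula along.
    interpolate-pt : ∀ {p} → p ≤ L → ∀ τ →
                     interpolate Φ (pt x y b L p) (τ S.* edgeSign x y b p) ≡ along p τ
    interpolate-pt {zero} _ τ =
      sym (trans (m≤n⇒m⊓n≡m (≤-trans (≤-reflexive (+-identityʳ _)) (proj₂ (compatible τ)))) (+-identityʳ _))
    interpolate-pt {suc p} 1+p≤L τ =
      trans (cong (interpolate Φ (pt x y b L (suc p))) (SignP.*-identityʳ τ)) (interpolate-pt-suc 1+p≤L τ)

  interpolate-lipschitz : ∀ {Φ} → Compatible Φ → SignLipschitz {E = CE} (interpolate Φ)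
  interpolate-lipschitz {Φ} compatible (ce x y x<y adj b p 1+p≤L) τ = forward , backward
    where
      open Path Φ x y b (compatible x y x<y adj b)
      s = edgeSign x y b p
      u = pt x y b L p
      v = pt x y b L (suc p)
      forward : interpolate Φ v (τ S.* s) ≤ interpolate Φ u τ + 1
      forward = begin
        interpolate Φ v (τ S.* s)          ≡⟨ interpolate-pt-suc 1+p≤L (τ S.* s) ⟩
        along (suc p) (τ S.* s)            ≤⟨ proj₁ (along-lipschitz 1+p≤L (τ S.* s)) ⟩
        along p (τ S.* s) + 1              ≡⟨ cong (_+ 1) (sym (interpolate-pt (<⇒≤ 1+p≤L) (τ S.* s))) ⟩
        interpolate Φ u (τ S.* s S.* s) + 1 ≡⟨ cong (λ t → interpolate Φ u t + 1) (sign-cancelʳ τ s) ⟩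
        interpolate Φ u τ + 1              ∎
        where open ≤-Reasoning
      backward : interpolate Φ u (τ S.* s) ≤ interpolate Φ v τ + 1
      backward = begin
        interpolate Φ u (τ S.* s)  ≡⟨ interpolate-pt (<⇒≤ 1+p≤L) τ ⟩
        along p τ                  ≤⟨ proj₂ (along-lipschitz 1+p≤L τ) ⟩
        along (suc p) τ + 1        ≡⟨ cong (_+ 1) (sym (interpolate-pt-suc 1+p≤L τ)) ⟩
        interpolate Φ v τ + 1      ∎
        where open ≤-Reasoning

  -- Only the first edge of each replacement path carries a sign, and it is incident to an original vertex.
  negative-walk-visits-orig : ∀ {u v} (W : Walk CE u v) → wsign CE W ≡ S.- →
    Σ (Fin m) λ z → Σ (Walk CE u (orig z)) λ W₁ → Σ (Walk CE (orig z) v) λ W₂ → W₁ ++ʷ W₂ ≡ W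
  negative-walk-visits-orig [] ()
  negative-walk-visits-orig W@(step _ (inj₁ (ce x _ _ _ _ zero _)) _) _ = x , [] , W , refl
  negative-walk-visits-orig (step s e@(inj₂ (ce x _ _ _ _ zero _)) W) _ = x , step s e [] , W , refl
  negative-walk-visits-orig (step s e@(inj₁ (ce _ _ _ _ _ (suc _) _)) W) negative
    with negative-walk-visits-orig W negative
  ... | z , W₁ , W₂ , refl = z , step s e W₁ , W₂ , refl
  negative-walk-visits-orig (step s e@(inj₂ (ce _ _ _ _ _ (suc _) _)) W) negative
    with negative-walk-visits-orig W negative
  ... | z , W₁ , W₂ , refl = z , step s e W₁ , W₂ , refl

  construction-girth : (Φ : Fin m → Fin m → Sign → ℕ) → (∀ z → Compatible (Φ z)) →
    (∀ z → Φ z z S.+ ≡ 0) → (∀ z → 2 * k ≤ Φ z z S.-) → UGirth≥ CE (2 * k)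
  construction-girth Φ compatible Φ⁺ Φ⁻ _ W _ negative with negative-walk-visits-orig W negative
  ... | z , W₁ , W₂ , refl = begin
    2 * k                                 ≤⟨ Φ⁻ z ⟩
    Φ z z S.-                             ≤⟨ lipschitz-closed-walk (interpolate-lipschitz (compatible z))
                                                                   (W₂ ++ʷ W₁) rotated-negative ⟩
    Φ z z S.+ + len CE (W₂ ++ʷ W₁)        ≡⟨ cong₂ _+_ (Φ⁺ z) (len-++ʷ W₂ W₁) ⟩
    len CE W₂ + len CE W₁                 ≡⟨ +-comm (len CE W₂) _ ⟩
    len CE W₁ + len CE W₂                 ≡⟨ len-++ʷ W₁ W₂ ⟨
    len CE (W₁ ++ʷ W₂)                    ∎
    where
      open ≤-Reasoning
      rotated-negative : wsign CE (W₂ ++ʷ W₁) ≡ S.-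
      rotated-negative = trans (wsign-++ʷ W₂ W₁)
        (trans (SignP.*-comm (wsign CE W₂) _) (trans (sym (wsign-++ʷ W₁ W₂)) negative))

  module NegativeCycle (2≤k : 2 ≤ k) {x y : Fin m} (x<y : x F.< y) (adj : KAdj x y)
      (∣w∣≥1 : 1 ≤ ∣ w x y ∣) (∣w∣≤k : ∣ w x y ∣ ≤ k) where

    L₁ L₂ : ℕ
    L₁ = ∣ w x y ∣
    L₂ = 2 * k ∸ ∣ w x y ∣

    L₂≥1 : 1 ≤ L₂
    L₂≥1 = ≤-trans (≤-trans (s≤s z≤n) 2≤k) (k≤2k∸a ∣w∣≤k)

    ptT ptF : ℕ → CV m
    ptT = pt x y true L₁
    ptF = pt x y false L₂

    -- Position along the cycle x → (path of sign w) → y → (other path) → x, with x counted last.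
    κ : CV m → ℕ
    κ (orig z) with z F.≟ x
    ... | yes _ = L₁ + L₂
    ... | no  _ = L₁
    κ (inner _ _ true  p) = p
    κ (inner _ _ false q) = L₁ + (L₂ ∸ q)

    κ-y : κ (orig y) ≡ L₁
    κ-y with y F.≟ x
    ... | yes y≡x = ⊥-elim (FinP.<-irrefl (sym y≡x) x<y)
    ... | no  _   = refl

    κ-T : ∀ {p} → 1 ≤ p → p ≤ L₁ → κ (ptT p) ≡ p
    κ-T {suc p} _ 1+p≤L₁ with m≤n⇒m<n∨m≡n 1+p≤L₁
    ... | inj₁ 1+p<L₁ rewrite pt-inner {x} {y} {true} (s≤s z≤n) 1+p<L₁ = refl
    ... | inj₂ 1+p≡L₁ rewrite pt-end {x} {y} {true} 1+p≡L₁ = trans κ-y (sym 1+p≡L₁)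

    κ-F : ∀ {q} → q ≤ L₂ → κ (ptF q) ≡ L₁ + (L₂ ∸ q)
    κ-F {zero} _ with x F.≟ x
    ... | yes _   = refl
    ... | no  x≢x = ⊥-elim (x≢x refl)
    κ-F {suc q} 1+q≤L₂ with m≤n⇒m<n∨m≡n 1+q≤L₂
    ... | inj₁ 1+q<L₂ rewrite pt-inner {x} {y} {false} (s≤s z≤n) 1+q<L₂ = refl
    ... | inj₂ 1+q≡L₂ rewrite pt-end {x} {y} {false} 1+q≡L₂ =
      trans κ-y (sym (trans (cong (λ r → L₁ + (r ∸ suc q)) (sym 1+q≡L₂))
                            (trans (cong (L₁ +_) (n∸n≡0 (suc q))) (+-identityʳ L₁))))

    ascend : ∀ j → suc j ≤ L₁ → Walk CE (ptT 1) (ptT (suc j))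
    ascend zero    _      = []
    ascend (suc j) 2+j≤L₁ = ascend j (<⇒≤ 2+j≤L₁) ++ʷ step S.+ (inj₁ (ce x y x<y adj true (suc j) 2+j≤L₁)) []

    descend : ∀ {v} q → q ≤ L₂ → v ≡ ptF q → Walk CE v (orig x)
    descend zero    _      refl = []
    descend (suc q) 1+q≤L₂ refl = step _ (inj₂ (ce x y x<y adj false q 1+q≤L₂)) (descend q (<⇒≤ 1+q≤L₂) refl)

    len-ascend : ∀ j le → len CE (ascend j le) ≡ j
    len-ascend zero    _  = refl
    len-ascend (suc j) le = trans (len-++ʷ (ascend j _) _) (trans (cong (_+ 1) (len-ascend j _)) (+-comm j 1))

    wsign-ascend : ∀ j le → wsign CE (ascend j le) ≡ S.+
    wsign-ascend zero    _  = refl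
    wsign-ascend (suc j) le = trans (wsign-++ʷ (ascend j _) _) (cong (S._* S.+) (wsign-ascend j _))

    ascending-ascend : ∀ j le → Ascending κ (ascend j le)
    ascending-ascend zero    _      = tt
    ascending-ascend (suc j) 2+j≤L₁ = ascending-++ʷ κ (ascend j _) _ (ascending-ascend j _)
      (subst₂ _<_ (sym (κ-T (s≤s z≤n) (<⇒≤ 2+j≤L₁))) (sym (κ-T (s≤s z≤n) 2+j≤L₁)) ≤-refl , tt)

    len-descend : ∀ {v} q le (eq : v ≡ ptF q) → len CE (descend q le eq) ≡ q
    len-descend zero    _ refl = refl
    len-descend (suc q) _ refl = cong suc (len-descend q _ refl)

    wsign-descend : ∀ {v} q le (eq : v ≡ ptF q) → 1 ≤ q → wsign CE (descend q le eq) ≡ psign (w x y) false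
    wsign-descend (suc zero)    _ refl _ = SignP.*-identityʳ _
    wsign-descend (suc (suc q)) _ refl _ = wsign-descend (suc q) _ refl (s≤s z≤n)

    ascending-descend : ∀ {v} q le (eq : v ≡ ptF q) → Ascending κ (descend q le eq)
    ascending-descend zero    _      refl = tt
    ascending-descend (suc q) 1+q≤L₂ refl =
      subst₂ _<_ (sym (κ-F 1+q≤L₂)) (sym (κ-F (<⇒≤ 1+q≤L₂)))
             (+-monoʳ-< L₁ (≤-reflexive (sym (+-∸-assoc 1 1+q≤L₂)))) ,
      ascending-descend q _ refl

    L₁-1+1≡L₁ : suc (L₁ ∸ 1) ≡ L₁
    L₁-1+1≡L₁ = trans (+-comm 1 _) (m∸n+n≡m ∣w∣≥1)

    junction : ptT (suc (L₁ ∸ 1)) ≡ ptF L₂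
    junction = trans (pt-end L₁-1+1≡L₁) (sym (pt-last L₂≥1))

    A : Walk CE (ptT 1) (ptT (suc (L₁ ∸ 1)))
    A = ascend (L₁ ∸ 1) (≤-reflexive L₁-1+1≡L₁)

    D : Walk CE (ptT (suc (L₁ ∸ 1))) (orig x)
    D = descend L₂ ≤-refl junction

    cycle : Walk CE (orig x) (orig x)
    cycle = step _ (inj₁ (ce x y x<y adj true 0 ∣w∣≥1)) (A ++ʷ D)

    len-cycle : len CE cycle ≡ 2 * k
    len-cycle = begin
      suc (len CE (A ++ʷ D))          ≡⟨ cong suc (len-++ʷ A D) ⟩
      suc (len CE A + len CE D)       ≡⟨ cong₂ (λ a d → suc (a + d)) (len-ascend (L₁ ∸ 1) _)
                                                                    (len-descend L₂ ≤-refl junction) ⟩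
      suc (L₁ ∸ 1) + L₂               ≡⟨ cong (_+ L₂) L₁-1+1≡L₁ ⟩
      L₁ + L₂                         ≡⟨ m+[n∸m]≡n (≤-trans ∣w∣≤k k≤2k) ⟩
      2 * k                           ∎
      where open ≡-Reasoning

    wsign-cycle : wsign CE cycle ≡ S.-
    wsign-cycle = begin
      s S.* wsign CE (A ++ʷ D)            ≡⟨ cong (s S.*_) (wsign-++ʷ A D) ⟩
      s S.* (wsign CE A S.* wsign CE D)   ≡⟨ cong₂ (λ a d → s S.* (a S.* d)) (wsign-ascend (L₁ ∸ 1) _)
                                                                          (wsign-descend L₂ ≤-refl junction L₂≥1) ⟩
      s S.* S.opposite s                  ≡⟨ SignP.s*opposite[s]≡- s ⟩
      S.-                                 ∎
      where
        open ≡-Reasoning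
        s = ℤ.sign (w x y)

    isCycle : IsCycle CE cycle
    isCycle =
      subst (3 ≤_) (sym len-cycle) (≤-trans (s≤s (s≤s (s≤s z≤n))) (*-monoʳ-≤ 2 2≤k)) ,
      ascending⇒unique κ (A ++ʷ D)
        (ascending-++ʷ κ A D (ascending-ascend _ _) (ascending-descend L₂ _ junction))

  negative-cycle : 2 ≤ k → ∀ {x y} → x F.< y → KAdj x y → 1 ≤ ∣ w x y ∣ → ∣ w x y ∣ ≤ k →
    Σ (CV m) λ u → Σ (Walk CE u u) λ C → IsCycle CE C × wsign CE C ≡ S.- × len CE C ≡ 2 * k
  negative-cycle 2≤k x<y adj ∣w∣≥1 ∣w∣≤k = orig _ , cycle , isCycle , wsign-cycle , len-cycle
    where open NegativeCycle 2≤k x<y adj ∣w∣≥1 ∣w∣≤k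

module Clique (k t′ n : ℕ) (2≤k : 2 ≤ k)
    (G : Graph n) (σ : Fin n → Fin n → Sign) (σ-sym : ∀ u v → σ u v ≡ σ v u)
    (bipartite : IsBipartite G) (girth : UGirth≥ (signedRel G σ) (2 * k))
    (w : Fin n → Fin n → ℤ) (c : Fin (suc (suc t′)) → Fin n) (c-injective : Injective _≡_ _≡_ c)
    (weightSpec : ∀ i j → i ≢ j → WeightSpec k G σ (c i) (c j) (w (c i) (c j))) where

  open SignedBipartite G σ σ-sym bipartite
  open Weights k 2≤k girth
  open Admissible

  m : ℕ
  m = suc (suc t′)

  W : Fin m → Fin m → ℤ
  W i j = w (c i) (c j)

  admissible : ∀ i j → i ≢ j → Admissible (c i) (c j) (W i j)
  admissible i j i≢j = weightSpec⇒admissible (λ eq → i≢j (c-injective eq)) (weightSpec i j i≢j)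

  -- The construction only reads W i j for i < j, so we may replace W by its symmetrisation ω.
  ω : Fin m → Fin m → ℤ
  ω i j with i F.<? j
  ... | yes _ = W i j
  ... | no  _ = W j i

  ω-< : ∀ {i j} → i F.< j → ω i j ≡ W i j
  ω-< {i} {j} i<j with i F.<? j
  ... | yes _   = refl
  ... | no  i≮j = ⊥-elim (i≮j i<j)

  ω-sym : ∀ i j → i ≢ j → ω i j ≡ ω j i
  ω-sym i j i≢j with i F.<? j | j F.<? i
  ... | yes i<j | yes j<i = ⊥-elim (FinP.<-asym i<j j<i)
  ... | yes _   | no  _   = refl
  ... | no  _   | yes _   = refl
  ... | no  i≮j | no  j≮i with FinP.<-cmp i j
  ...   | tri< i<j _ _ = ⊥-elim (i≮j i<j)
  ...   | tri≈ _ i≡j _ = ⊥-elim (i≢j i≡j)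
  ...   | tri> _ _ j<i = ⊥-elim (j≮i j<i)

  ω-admissible : ∀ i j → i ≢ j → Admissible (c i) (c j) (ω i j)
  ω-admissible i j i≢j with i F.<? j
  ... | yes _ = admissible i j i≢j
  ... | no  _ = admissible-reverse (admissible j i (≢-sym i≢j))

  ω₀ : Fin m → Fin m → ℤ
  ω₀ r z with r FinP.≟ z
  ... | yes _ = ℤ.+ 0
  ... | no  _ = ω r z

  root-triangle-wide : ∀ r x y → x ≢ y →
    WideTriangle k (∣ ω₀ r x ∣) (∣ ω x y ∣) (∣ ω₀ r y ∣)
                   (ℤ.sign (ω₀ r x) S.* ℤ.sign (ω x y) S.* ℤ.sign (ω₀ r y))
  root-triangle-wide r x y x≢y with r FinP.≟ x | r FinP.≟ y
  ... | yes refl | yes refl = ⊥-elim (x≢y refl)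
  ... | yes refl | no  _    = isosceles-wide (∣a∣≤k (ω-admissible r y x≢y)) (SignP.s*s≡+ (ℤ.sign (ω r y)))
  ... | no  r≢x  | yes refl rewrite ω-sym r x r≢x =
    wide-rotate (isosceles-wide (∣a∣≤k (ω-admissible x r (≢-sym r≢x)))
                                (trans (SignP.*-identityʳ _) (SignP.s*s≡+ (ℤ.sign (ω x r)))))
  ... | no  r≢x  | no  r≢y  =
    admissible-triangle-wide (ω-admissible r x r≢x) (ω-admissible x y x≢y)
                             (admissible-reverse (ω-admissible r y r≢y))

  -- Φ r z (wsign P) ≤ len P for every walk P from r to z in the construction, while Φ r r S.- = 2k.
  Φ : Fin m → Fin m → Sign → ℕ
  Φ r z τ = arc k (∣ ω₀ r z ∣) (ℤ.sign (ω₀ r z) S.* τ)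

  Φ-root : ∀ r τ → Φ r r τ ≡ arc k 0 τ
  Φ-root r τ with r FinP.≟ r
  ... | yes _   = refl
  ... | no  r≢r = ⊥-elim (r≢r refl)

  Φ-step : ∀ r x y → x ≢ y → ∀ b τ → Φ r y (τ S.* psign (ω x y) b) ≤ Φ r x τ + plen k (ω x y) b
  Φ-step r x y x≢y b τ = begin
    Φ r y (τ S.* psign (ω x y) b)
      ≡⟨ cong (λ s → arc k (∣ ω₀ r y ∣) (sc S.* (τ S.* s))) (psign≡ (ω x y) b) ⟩
    arc k (∣ ω₀ r y ∣) (sc S.* (τ S.* (sb S.* β))) ≡⟨ cong (arc k (∣ ω₀ r y ∣)) (sign-rearrange sa sb sc τ β) ⟨
    arc k (∣ ω₀ r y ∣) (sa S.* sb S.* sc S.* (sa S.* τ) S.* β)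
                                                   ≤⟨ arc-triangle (root-triangle-wide r x y x≢y) (sa S.* τ) β ⟩
    Φ r x τ + arc k (∣ ω x y ∣) β                  ≡⟨ cong (Φ r x τ +_) (plen≡arc k (ω x y) b) ⟨
    Φ r x τ + plen k (ω x y) b                     ∎
    where
      open ≤-Reasoning
      sa = ℤ.sign (ω₀ r x)
      sb = ℤ.sign (ω x y)
      sc = ℤ.sign (ω₀ r y)
      β  = kindSign b

  open Construction k (λ i j → i ≢ j) W

  compatible : ∀ r → Compatible (Φ r)
  compatible r x y x<y x≢y b τ =
    subst (λ a → Φ r y (τ S.* psign a b) ≤ Φ r x τ + plen k a b) (ω-< x<y) (Φ-step r x y x≢y b τ) ,
    subst (λ a → Φ r x (τ S.* psign a b) ≤ Φ r y τ + plen k a b) (trans (ω-sym y x (≢-sym x≢y)) (ω-< x<y))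
          (Φ-step r y x (≢-sym x≢y) b τ)

  weight-bounds : ∀ i j → i ≢ j → 1 ≤ ∣ W i j ∣ × ∣ W i j ∣ ≤ k
  weight-bounds i j i≢j = ∣a∣≥1 (admissible i j i≢j) , ∣a∣≤k (admissible i j i≢j)

  clique-wide : IsWide k (λ i j → i ≢ j) W
  clique-wide =
    weight-bounds ,
    construction-girth Φ compatible (λ r → Φ-root r S.+) (λ r → ≤-reflexive (sym (Φ-root r S.-))) ,
    negative-cycle 2≤k (s≤s z≤n) 0≢1 (proj₁ (weight-bounds _ _ 0≢1)) (proj₂ (weight-bounds _ _ 0≢1))
    where
      0≢1 : F.zero ≢ F.suc {suc t′} F.zero
      0≢1 ()

lemma3 : (k t n : ℕ) → 2 ≤ k → 1 ≤ t →
    (G : Graph n) (σ : Fin n → Fin n → Sign) → (∀ u v → σ u v ≡ σ v u) →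
    IsBipartite G → IsPartialTTree t (Adj G) →
    UGirth≥ (signedRel G σ) (2 * k) →
    (H : Graph n) → IsTTree t (Adj H) → (∀ u v → Adj G u v → Adj H u v) →
    (w : Fin n → Fin n → ℤ) → (∀ u v → Adj H u v → WeightSpec k G σ u v (w u v)) →
    (c : Fin (suc t) → Fin n) → Injective _≡_ _≡_ c → (∀ i j → i ≢ j → Adj H (c i) (c j)) →
    IsWide k (λ i j → i ≢ j) (λ i j → w (c i) (c j))
lemma3 k (suc t′) n 2≤k _ G σ σ-sym bipartite _ girth H _ _ w weightSpec c c-injective clique =
  Clique.clique-wide k t′ n 2≤k G σ σ-sym bipartite girth w c c-injective
    (λ i j i≢j → weightSpec (c i) (c j) (clique i j i≢j))
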